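{- Let $G=(V,E,w)$ be a finite connected graph with $|V|=n\ge2$ and weights $w:E\to\mathbb{R}_{>0}$. Let $H$ be an arbitrary rooted binary hierarchy on $V$. There exists a rooted binary hierarchy $T$ on $V$, all of whose clusters induce connected subgraphs of $G$, such that for every edge $xy\in E$, $$|C_T(x,y)|\le|C_H(x,y)|.$$ Consequently, $$\operatorname{cost}_D^-(T)\le\operatorname{cost}_D^-(H)\quad\text{and}\quad\operatorname{cost}_D(T)\le\operatorname{cost}_D(H).$$
   Context: A rooted binary hierarchy $T$ on $V$ is a rooted tree whose leaves are the vertices of $V$ and whose internal nodes have exactly two children; each node is identified with the set of leaves in its subtree (a cluster), and $C_T(x,y)$ is the cluster of the lowest common ancestor of $x,y$. The standard and shifted Dasgupta objectives are $\operatorname{cost}_D(T)=\sum_{xy\in E}w_{xy}|C_T(x,y)|$ and $\operatorname{cost}_D^-(T)=\sum_{xy\in E}w_{xy}(|C_T(x,y)|-1)$. -}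

module Defs where

open import Level using (Level; 0ℓ; _⊔_) renaming (suc to lsuc)
open import Algebra.Bundles using (CommutativeRing)
open import Algebra.Apartness.Structures using (IsHeytingField)
import Algebra.Definitions.RawMonoid as RawMonoidDefs
open import Data.Fin.Base using (Fin)
open import Data.Fin.Properties using (_<?_)
open import Data.Fin.Subset using (Subset; ⁅_⁆; _∪_; _∈_; ∣_∣)
open import Data.Fin.Subset.Properties
  using (_∈?_; x∈⁅x⁆; x∈⁅y⁆⇒x≡y; x∈p∪q⁺; x∈p∪q⁻)
open import Data.List.Base
  using (List; []; _∷_; _++_; map; foldr; filter; allFin; cartesianProduct)
import Data.List.Membership.Propositional as List
open import Data.List.Membership.Propositional.Properties
  using (∈-++⁺ˡ; ∈-++⁺ʳ; ∈-++⁻; ∈-allFin)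
open import Data.List.Properties using (++-assoc)
import Data.List.Relation.Unary.All as All
open import Data.List.Relation.Unary.AllPairs using ([]; _∷_)
open import Data.List.Relation.Unary.Any using (here; there)
open import Data.List.Relation.Unary.Unique.Propositional using (Unique)
open import Data.List.Relation.Unary.Unique.Propositional.Properties using (allFin⁺)
open import Data.List.Relation.Binary.Permutation.Propositional
  using (_↭_; ↭-sym; ↭⇒↭ₛ)
open import Data.List.Relation.Binary.Permutation.Propositional.Properties
  using (∈-resp-↭)
open import Data.List.Relation.Binary.Permutation.Setoid.Properties
  using (Unique-resp-↭)
open import Data.Nat.Base using (ℕ)
open import Data.Product.Base using (_×_; _,_)
open import Data.Sum.Base using (_⊎_; inj₁; inj₂)
open import Data.Tree.Binary using (Tree; leaf; node; module Leaves)
open import Data.Unit.Base using (⊤)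
open import Relation.Binary.Core using (Rel)
open import Relation.Binary.Construct.Closure.ReflexiveTransitive using (Star)
open import Relation.Binary.Definitions using (Symmetric; Irreflexive; Decidable)
open import Relation.Binary.PropositionalEquality
  using (_≡_; refl; sym; subst; setoid)
open import Relation.Binary.Structures using (IsStrictPartialOrder)
open import Relation.Nullary using (¬_; yes; no; contradiction; _×-dec_)

private
  variable
    c ℓ₁ ℓ₂ : Level
    n : ℕ

-- Ordered fields in the constructive sense: apartness is "x < y or y < x", and
-- neither trichotomy nor decidability of _<_ is assumed, so that the field of
-- real numbers is an instance both classically and constructively.
record OrderedField (c ℓ₁ ℓ₂ : Level) : Set (lsuc (c ⊔ ℓ₁ ⊔ ℓ₂)) where
  infix  8 -_
  infixl 7 _*_
  infixl 6 _+_
  infix  4 _≈_ _<_ _#_ _≤_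
  field
    Carrier : Set c
    _≈_     : Rel Carrier ℓ₁
    _<_     : Rel Carrier ℓ₂
    _+_     : Carrier → Carrier → Carrier
    _*_     : Carrier → Carrier → Carrier
    -_      : Carrier → Carrier
    0#      : Carrier
    1#      : Carrier

  _#_ : Rel Carrier ℓ₂
  x # y = x < y ⊎ y < x

  field
    isHeytingField       : IsHeytingField _≈_ _#_ _+_ _*_ -_ 0# 1#
    isStrictPartialOrder : IsStrictPartialOrder _≈_ _<_
    +-monoˡ-<            : ∀ {x y} z → x < y → (x + z) < (y + z)
    *-pos                : ∀ {x y} → 0# < x → 0# < y → 0# < (x * y)

  commutativeRing : CommutativeRing c ℓ₁
  commutativeRing = record
    { isCommutativeRing = IsHeytingField.isCommutativeRing isHeytingField }

  open CommutativeRing commutativeRing public using (_-_; +-rawMonoid)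

  _≤_ : Rel Carrier ℓ₂
  x ≤ y = ¬ (y < x)

  fromℕ : ℕ → Carrier
  fromℕ k = k ⋆ 1#
    where open RawMonoidDefs +-rawMonoid using () renaming (_×_ to _⋆_)

  sum : List Carrier → Carrier
  sum = foldr _+_ 0#

record Graph (n : ℕ) : Set₁ where
  infix 4 _~_ _~?_
  field
    _~_      : Rel (Fin n) 0ℓ
    _~?_     : Decidable _~_
    ~-sym    : Symmetric _~_
    ~-irrefl : Irreflexive _≡_ _~_

  -- Each edge xy is listed once, as the pair (x , y) with x < y.
  edges : List (Fin n × Fin n)
  edges = filter (λ (x , y) → (x <? y) ×-dec (x ~? y))
                 (cartesianProduct (allFin n) (allFin n))

  Connected : Set
  Connected = ∀ x y → Star _~_ x y

  InducesConnected : Subset n → Set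
  InducesConnected S =
    ∀ {x y} → x ∈ S → y ∈ S → Star (λ u v → u ∈ S × v ∈ S × u ~ v) x y

-- Only the values of weight at adjacent pairs matter; the others are
-- unconstrained and unused.
record EdgeWeights (F : OrderedField c ℓ₁ ℓ₂) (G : Graph n) : Set (c ⊔ ℓ₁ ⊔ ℓ₂) where
  open OrderedField F
  open Graph G
  field
    weight     : Fin n → Fin n → Carrier
    weight-sym : ∀ {x y} → x ~ y → weight x y ≈ weight y x
    weight-pos : ∀ {x y} → x ~ y → 0# < weight x y

BinTree : ℕ → Set
BinTree n = Tree ⊤ (Fin n)

record Hierarchy (n : ℕ) : Set where
  field
    tree   : BinTree n
    leaves : Leaves.toList tree ↭ allFin n

open Hierarchy public using (tree)

cluster : BinTree n → Subset n
cluster (leaf x)     = ⁅ x ⁆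
cluster (node l _ r) = cluster l ∪ cluster r

-- s ⊑ t: s is the subtree of t rooted at some node of t.
infix 4 _⊑_
data _⊑_ {n : ℕ} (s : BinTree n) : BinTree n → Set where
  root  : s ⊑ s
  left  : ∀ {l m r} → s ⊑ l → s ⊑ node l m r
  right : ∀ {l m r} → s ⊑ r → s ⊑ node l m r

-- The subtree rooted at the lowest common ancestor of the leaves x and y,
-- provided both occur in the tree; see lca-isLCA.
lca : BinTree n → Fin n → Fin n → BinTree n
lca (leaf z)     x y = leaf z
lca (node l m r) x y
  with (x ∈? cluster l) ×-dec (y ∈? cluster l)
     | (x ∈? cluster r) ×-dec (y ∈? cluster r)
... | yes _ | _     = lca l x y
... | no  _ | yes _ = lca r x y
... | no  _ | no  _ = node l m r

C : Hierarchy n → Fin n → Fin n → Subset n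
C T x y = cluster (lca (tree T) x y)

ConnectedClusters : Graph n → Hierarchy n → Set
ConnectedClusters G T = ∀ {s} → s ⊑ tree T → Graph.InducesConnected G (cluster s)

module _ (F : OrderedField c ℓ₁ ℓ₂) (G : Graph n) (w : EdgeWeights F G) where
  open OrderedField F
  open EdgeWeights w

  costD : Hierarchy n → Carrier
  costD T = sum (map (λ (x , y) → weight x y * fromℕ ∣ C T x y ∣) (Graph.edges G))

  costD⁻ : Hierarchy n → Carrier
  costD⁻ T = sum (map (λ (x , y) → weight x y * (fromℕ ∣ C T x y ∣ - 1#)) (Graph.edges G))

record IsLCA {n} (t : BinTree n) (x y : Fin n) (s : BinTree n) : Set where
  field
    subtree   : s ⊑ t
    ancestorˡ : x ∈ cluster s
    ancestorʳ : y ∈ cluster s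
    lowest    : ∀ {s′} → s′ ⊑ t → x ∈ cluster s′ → y ∈ cluster s′ → s ⊑ s′

private
  toDiffList-++ : (t : BinTree n) (xs : List (Fin n)) →
                  Leaves.toDiffList t xs ≡ Leaves.toList t ++ xs
  toDiffList-++ (leaf x)     xs = refl
  toDiffList-++ (node l _ r) xs
    rewrite toDiffList-++ r xs
          | toDiffList-++ l (Leaves.toList r ++ xs)
          | toDiffList-++ l (Leaves.toList r)
    = sym (++-assoc (Leaves.toList l) (Leaves.toList r) xs)

  toList-node : (l r : BinTree n) {m : ⊤} →
                Leaves.toList (node l m r) ≡ Leaves.toList l ++ Leaves.toList r
  toList-node l r = toDiffList-++ l (Leaves.toList r)

  ∈-cluster⇒∈-leaves : (t : BinTree n) {x : Fin n} →
                       x ∈ cluster t → x List.∈ Leaves.toList t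
  ∈-cluster⇒∈-leaves (leaf z) x∈ = here (x∈⁅y⁆⇒x≡y z x∈)
  ∈-cluster⇒∈-leaves (node l _ r) {x} x∈ with x∈p∪q⁻ (cluster l) (cluster r) x∈
  ... | inj₁ p = subst (x List.∈_) (sym (toList-node l r))
                   (∈-++⁺ˡ (∈-cluster⇒∈-leaves l p))
  ... | inj₂ p = subst (x List.∈_) (sym (toList-node l r))
                   (∈-++⁺ʳ (Leaves.toList l) (∈-cluster⇒∈-leaves r p))

  ∈-leaves⇒∈-cluster : (t : BinTree n) {x : Fin n} →
                       x List.∈ Leaves.toList t → x ∈ cluster t
  ∈-leaves⇒∈-cluster (leaf z) (here refl) = x∈⁅x⁆ z
  ∈-leaves⇒∈-cluster (node l _ r) {x} x∈
    with ∈-++⁻ (Leaves.toList l) (subst (x List.∈_) (toList-node l r) x∈)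
  ... | inj₁ p = x∈p∪q⁺ (inj₁ (∈-leaves⇒∈-cluster l p))
  ... | inj₂ p = x∈p∪q⁺ (inj₂ (∈-leaves⇒∈-cluster r p))

  ⊑⇒⊆ : {s t : BinTree n} → s ⊑ t → {x : Fin n} → x ∈ cluster s → x ∈ cluster t
  ⊑⇒⊆ root      x∈ = x∈
  ⊑⇒⊆ (left p)  x∈ = x∈p∪q⁺ (inj₁ (⊑⇒⊆ p x∈))
  ⊑⇒⊆ (right p) x∈ = x∈p∪q⁺ (inj₂ (⊑⇒⊆ p x∈))

  unique-++⁻ : ∀ {a} {A : Set a} (xs : List A) {ys} → Unique (xs ++ ys) →
               Unique xs × Unique ys × (∀ {x} → x List.∈ xs → ¬ x List.∈ ys)
  unique-++⁻ []       u = [] , u , λ ()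
  unique-++⁻ (x ∷ xs) (x∉ ∷ u) with unique-++⁻ xs u
  ... | uxs , uys , dis = All.tabulate (λ p → All.lookup x∉ (∈-++⁺ˡ p)) ∷ uxs , uys ,
    λ { (here refl) q → All.lookup x∉ (∈-++⁺ʳ xs q) refl ; (there p) q → dis p q }

  lca-isLCA′ : (t : BinTree n) → Unique (Leaves.toList t) → ∀ {x y} →
               x ∈ cluster t → y ∈ cluster t → IsLCA t x y (lca t x y)
  lca-isLCA′ (leaf z) u x∈ y∈ = record
    { subtree = root ; ancestorˡ = x∈ ; ancestorʳ = y∈
    ; lowest = λ { root _ _ → root } }
  lca-isLCA′ (node l m r) u {x} {y} x∈ y∈
    with unique-++⁻ (Leaves.toList l) (subst Unique (toList-node l r) u)
  ... | ul , ur , dis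
    with (x ∈? cluster l) ×-dec (y ∈? cluster l)
       | (x ∈? cluster r) ×-dec (y ∈? cluster r)
  ... | yes (xl , yl) | _ = record
    { subtree = left A.subtree ; ancestorˡ = A.ancestorˡ ; ancestorʳ = A.ancestorʳ
    ; lowest = λ { root _ _ → left A.subtree
                 ; (left p) a b → A.lowest p a b
                 ; (right p) a _ → contradiction (∈-cluster⇒∈-leaves r (⊑⇒⊆ p a))
                                                 (dis (∈-cluster⇒∈-leaves l xl)) } }
    where module A = IsLCA (lca-isLCA′ l ul xl yl)
  ... | no ¬l | yes (xr , yr) = record
    { subtree = right A.subtree ; ancestorˡ = A.ancestorˡ ; ancestorʳ = A.ancestorʳ
    ; lowest = λ { root _ _ → right A.subtree
                 ; (right p) a b → A.lowest p a b
                 ; (left p) a b → contradiction (⊑⇒⊆ p a , ⊑⇒⊆ p b) ¬l } }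
    where module A = IsLCA (lca-isLCA′ r ur xr yr)
  ... | no ¬l | no ¬r = record
    { subtree = root ; ancestorˡ = x∈ ; ancestorʳ = y∈
    ; lowest = λ { root _ _ → root
                 ; (left p) a b → contradiction (⊑⇒⊆ p a , ⊑⇒⊆ p b) ¬l
                 ; (right p) a b → contradiction (⊑⇒⊆ p a , ⊑⇒⊆ p b) ¬r } }

lca-isLCA : (T : Hierarchy n) (x y : Fin n) → IsLCA (tree T) x y (lca (tree T) x y)
lca-isLCA {n} T x y = lca-isLCA′ (tree T) unique (occurs x) (occurs y)
  where
  V↭leaves : allFin n ↭ Leaves.toList (tree T)
  V↭leaves = ↭-sym (Hierarchy.leaves T)
  unique : Unique (Leaves.toList (tree T))
  unique = Unique-resp-↭ (setoid (Fin n)) (↭⇒↭ₛ V↭leaves) (allFin⁺ n)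
  occurs : ∀ z → z ∈ cluster (tree T)
  occurs z = ∈-leaves⇒∈-cluster (tree T) (∈-resp-↭ V↭leaves (∈-allFin z))

{-# OPTIONS --safe #-}

-- Build T bottom-up along H, keeping for each cluster A of H a forest whose
-- trees have the connected components of G[A] as leaf sets.  At a node A = L ∪ R
-- the components of L and of R are merged, along edges of G, into those of A.
-- An edge whose ends lie in different trees before such a merge joins L to R, so
-- its lowest common ancestor in H is A, while its new cluster stays inside A.
module Submission where

open import Defs
open import Algebra.Apartness.Structures using (IsHeytingField)
open import Algebra.Bundles using (CommutativeRing)
import Algebra.Properties.Group as GroupProperties
import Algebra.Properties.Ring as RingProperties
open import Data.Fin.Base using (Fin)
open import Data.Fin.Properties using (any?)
open import Data.Fin.Subset using (⁅_⁆; _∪_; ∣_∣; _∈_; _∉_; _⊆_)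
open import Data.Fin.Subset.Properties
  using (_∈?_; x∈⁅x⁆; x∈⁅y⁆⇒x≡y; x∈p∪q⁺; x∈p∪q⁻; p⊆q⇒∣p∣≤∣q∣)
open import Data.List.Base
  using (List; []; _∷_; _++_; map; foldr; concatMap; allFin; cartesianProduct)
import Data.List.Membership.Propositional as List
open import Data.List.Membership.Propositional.Properties
  using (∈-++⁺ˡ; ∈-++⁺ʳ; ∈-++⁻; ∈-allFin; ∈-concatMap⁻)
open import Data.List.Properties using (++-assoc; ++-identityʳ)
open import Data.List.Relation.Binary.Permutation.Propositional
  using (_↭_; ↭-refl; ↭-reflexive; ↭-sym; ↭-trans; ↭⇒↭ₛ; module PermutationReasoning)
open import Data.List.Relation.Binary.Permutation.Propositional.Properties
  using (∈-resp-↭; ++⁺; ++⁺ˡ; shifts)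
open import Data.List.Relation.Binary.Permutation.Setoid.Properties
  using (Unique-resp-↭)
open import Data.List.Relation.Unary.All as All using (All; []; _∷_)
open import Data.List.Relation.Unary.All.Properties using (all-filter)
open import Data.List.Relation.Unary.AllPairs using (AllPairs; []; _∷_)
open import Data.List.Relation.Unary.Any using (here; there)
open import Data.List.Relation.Unary.Unique.Propositional using (Unique)
open import Data.List.Relation.Unary.Unique.Propositional.Properties using (allFin⁺)
open import Data.Nat.Base using (ℕ; zero; suc; _≤_; z≤n; s≤s)
open import Data.Nat.Properties using (≤-trans; ≤-reflexive)
open import Data.Product.Base using (∃-syntax; ∃₂; _×_; _,_; proj₁; proj₂)
open import Data.Sum.Base using (_⊎_; inj₁; inj₂; [_,_]; map₁)
open import Data.Tree.Binary using (leaf; node; module Leaves)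
open import Data.Unit.Base using (tt)
open import Function.Base using (_∘_; id; case_of_)
open import Level using (Level)
open import Relation.Binary.Bundles using (StrictPartialOrder)
open import Relation.Binary.Construct.Closure.ReflexiveTransitive
  using (Star; ε; _◅_; _◅◅_; reverse) renaming (map to Star-map)
open import Relation.Binary.Core using (Rel)
open import Relation.Binary.Definitions using (Symmetric; Decidable)
open import Relation.Binary.PropositionalEquality
  using (_≡_; refl; sym; cong; subst; setoid) renaming (trans to ≡-trans)
import Relation.Binary.Construct.StrictToNonStrict as StrictToNonStrict
import Relation.Binary.Reasoning.StrictPartialOrder as StrictPartialOrderReasoning
open import Relation.Binary.Structures using (IsStrictPartialOrder)
open import Relation.Nullary using (¬_; yes; no; contradiction; _×-dec_)

private
  variable
    a p c ℓ₁ ℓ₂ : Level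
    A : Set a
    n : ℕ

module _ {R : Rel A p} where

  AllPairs-++⁻ : ∀ xs {ys} → AllPairs R (xs ++ ys) →
                 AllPairs R xs × AllPairs R ys × All (λ x → All (R x) ys) xs
  AllPairs-++⁻ []       rs       = [] , rs , []
  AllPairs-++⁻ (x ∷ xs) (r ∷ rs) =
    let rxs , rys , rxys = AllPairs-++⁻ xs rs
    in All.tabulate (All.lookup r ∘ ∈-++⁺ˡ) ∷ rxs , rys ,
       All.tabulate (All.lookup r ∘ ∈-++⁺ʳ xs) ∷ rxys

  AllPairs-lookup : Symmetric R → ∀ {xs x y} → AllPairs R xs →
                    x List.∈ xs → y List.∈ xs → x ≡ y ⊎ R x y
  AllPairs-lookup R-sym (r ∷ rs) (here refl) (here refl) = inj₁ refl
  AllPairs-lookup R-sym (r ∷ rs) (here refl) (there y∈)  = inj₂ (All.lookup r y∈)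
  AllPairs-lookup R-sym (r ∷ rs) (there x∈)  (here refl) = inj₂ (R-sym (All.lookup r x∈))
  AllPairs-lookup R-sym (r ∷ rs) (there x∈)  (there y∈)  = AllPairs-lookup R-sym rs x∈ y∈

Unique-++⇒disjoint : ∀ (xs : List A) {ys x} → Unique (xs ++ ys) →
                     x List.∈ xs → ¬ x List.∈ ys
Unique-++⇒disjoint xs u x∈xs x∈ys =
  All.lookup (All.lookup (proj₂ (proj₂ (AllPairs-++⁻ xs u))) x∈xs) x∈ys refl

leaves : BinTree n → List (Fin n)
leaves = Leaves.toList

toDiffList-++ : (t : BinTree n) (xs : List (Fin n)) →
                Leaves.toDiffList t xs ≡ leaves t ++ xs
toDiffList-++ (leaf x)     xs = refl
toDiffList-++ (node l _ r) xs
  rewrite toDiffList-++ r xs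
        | toDiffList-++ l (leaves r ++ xs)
        | toDiffList-++ l (leaves r)
  = sym (++-assoc (leaves l) (leaves r) xs)

leaves-node : ∀ (l : BinTree n) {m} r → leaves (node l m r) ≡ leaves l ++ leaves r
leaves-node l r = toDiffList-++ l (leaves r)

∈-leaves⁺ : ∀ (t : BinTree n) {x} → x ∈ cluster t → x List.∈ leaves t
∈-leaves⁺ (leaf z) x∈ = here (x∈⁅y⁆⇒x≡y z x∈)
∈-leaves⁺ (node l _ r) {x} x∈ =
  subst (x List.∈_) (sym (leaves-node l r))
    ([ ∈-++⁺ˡ ∘ ∈-leaves⁺ l , ∈-++⁺ʳ (leaves l) ∘ ∈-leaves⁺ r ]
      (x∈p∪q⁻ (cluster l) (cluster r) x∈))

∈-leaves⁻ : ∀ (t : BinTree n) {x} → x List.∈ leaves t → x ∈ cluster t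
∈-leaves⁻ (leaf z) (here refl) = x∈⁅x⁆ z
∈-leaves⁻ (node l _ r) {x} x∈
  with ∈-++⁻ (leaves l) (subst (x List.∈_) (leaves-node l r) x∈)
... | inj₁ x∈l = x∈p∪q⁺ (inj₁ (∈-leaves⁻ l x∈l))
... | inj₂ x∈r = x∈p∪q⁺ (inj₂ (∈-leaves⁻ r x∈r))

cluster-nonempty : (t : BinTree n) → ∃[ x ] x ∈ cluster t
cluster-nonempty (leaf z)     = z , x∈⁅x⁆ z
cluster-nonempty (node l _ _) =
  let x , x∈l = cluster-nonempty l in x , x∈p∪q⁺ (inj₁ x∈l)

⊑⇒⊆ : {s t : BinTree n} → s ⊑ t → cluster s ⊆ cluster t
⊑⇒⊆ root      x∈ = x∈
⊑⇒⊆ (left q)  x∈ = x∈p∪q⁺ (inj₁ (⊑⇒⊆ q x∈))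
⊑⇒⊆ (right q) x∈ = x∈p∪q⁺ (inj₂ (⊑⇒⊆ q x∈))

⊑-left : ∀ {l r t : BinTree n} {m} → node l m r ⊑ t → l ⊑ t
⊑-left root      = left root
⊑-left (left q)  = left (⊑-left q)
⊑-left (right q) = right (⊑-left q)

⊑-right : ∀ {l r t : BinTree n} {m} → node l m r ⊑ t → r ⊑ t
⊑-right root      = right root
⊑-right (left q)  = left (⊑-right q)
⊑-right (right q) = right (⊑-right q)

subtree-unique : {s t : BinTree n} → s ⊑ t → Unique (leaves t) → Unique (leaves s)
subtree-unique root u = u
subtree-unique {t = node l _ r} (left q) u =
  subtree-unique q (proj₁ (AllPairs-++⁻ (leaves l) (subst Unique (leaves-node l r) u)))
subtree-unique {t = node l _ r} (right q) u =
  subtree-unique q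
    (proj₁ (proj₂ (AllPairs-++⁻ (leaves l) (subst Unique (leaves-node l r) u))))

children-disjoint : ∀ {l r t : BinTree n} {m} → Unique (leaves t) → node l m r ⊑ t →
                    ∀ {x} → x ∈ cluster l → x ∉ cluster r
children-disjoint {l = l} {r = r} u q x∈l x∈r =
  Unique-++⇒disjoint (leaves l) (subst Unique (leaves-node l r) (subtree-unique q u))
    (∈-leaves⁺ l x∈l) (∈-leaves⁺ r x∈r)

Hierarchy-unique : (H : Hierarchy n) → Unique (leaves (tree H))
Hierarchy-unique {n} H =
  Unique-resp-↭ (setoid (Fin n)) (↭⇒↭ₛ (↭-sym (Hierarchy.leaves H))) (allFin⁺ n)

crossing-lca : ∀ (H : Hierarchy n) {l m r} → node l m r ⊑ tree H → ∀ {x y} →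
               x ∈ cluster l × y ∈ cluster r ⊎ x ∈ cluster r × y ∈ cluster l →
               lca (tree H) x y ≡ node l m r
crossing-lca H {l} {m} {r} q {x} {y} xy =
  [ (λ (x∈l , y∈r) → meets x∈l y∈r L.ancestorˡ L.ancestorʳ
                           (L.lowest q (x∈p∪q⁺ (inj₁ x∈l)) (x∈p∪q⁺ (inj₂ y∈r))))
  , (λ (x∈r , y∈l) → meets y∈l x∈r L.ancestorʳ L.ancestorˡ
                           (L.lowest q (x∈p∪q⁺ (inj₂ x∈r)) (x∈p∪q⁺ (inj₁ y∈l)))) ] xy
  where
  module L = IsLCA (lca-isLCA H x y)
  disjoint : ∀ {z} → z ∈ cluster l → z ∉ cluster r
  disjoint = children-disjoint (Hierarchy-unique H) q
  meets : ∀ {s u v} → u ∈ cluster l → v ∈ cluster r →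
          u ∈ cluster s → v ∈ cluster s → s ⊑ node l m r → s ≡ node l m r
  meets _   _   _   _   root       = refl
  meets _   v∈r _   v∈s (left q′)  = contradiction v∈r (disjoint (⊑⇒⊆ q′ v∈s))
  meets u∈l _   u∈s _   (right q′) = contradiction (⊑⇒⊆ q′ u∈s) (disjoint u∈l)

module _ (G : Graph n) where
  open Graph G

  Adjacent : Rel (BinTree n) _
  Adjacent t u = ∃₂ λ x y → x ∈ cluster t × y ∈ cluster u × x ~ y

  adjacent? : Decidable Adjacent
  adjacent? t u = any? λ x → any? λ y → x ∈? cluster t ×-dec y ∈? cluster u ×-dec x ~? y

  Separated : Rel (BinTree n) _
  Separated t u = ¬ Adjacent t u

  Separated-sym : ∀ t u → Separated t u → Separated u t
  Separated-sym t u ¬tu (x , y , x∈ , y∈ , x~y) = ¬tu (y , x , y∈ , x∈ , ~-sym x~y)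

  Separated-node : ∀ v t u → Separated v t → Separated v u → Separated v (node t tt u)
  Separated-node v t u ¬vt ¬vu (x , y , x∈ , y∈ , x~y) =
    [ (λ y∈t → ¬vt (x , y , x∈ , y∈t , x~y)) , (λ y∈u → ¬vu (x , y , x∈ , y∈u , x~y)) ]
      (x∈p∪q⁻ (cluster t) (cluster u) y∈)

  absorb : BinTree n → List (BinTree n) → List (BinTree n)
  absorb t []       = t ∷ []
  absorb t (u ∷ us) with adjacent? t u
  ... | yes _ = absorb (node t tt u) us
  ... | no  _ = u ∷ absorb t us

  absorb-All : ∀ {P : BinTree n → Set p} →
               (∀ {t u} → Adjacent t u → P t → P u → P (node t tt u)) →
               ∀ {t us} → P t → All P us → All P (absorb t us)
  absorb-All join {us = []}         pt []         = pt ∷ []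
  absorb-All join {t} {us = u ∷ us} pt (pu ∷ pus) with adjacent? t u
  ... | yes tu = absorb-All join (join tu pt pu) pus
  ... | no  _  = pu ∷ absorb-All join pt pus

  absorb-separated : ∀ t {us} → AllPairs Separated us → AllPairs Separated (absorb t us)
  absorb-separated t []                 = [] ∷ []
  absorb-separated t {u ∷ us} (su ∷ ss) with adjacent? t u
  ... | yes _  = absorb-separated (node t tt u) ss
  ... | no ¬tu = absorb-All (λ {v} {w} _ → Separated-node u v w) (Separated-sym t u ¬tu) su
               ∷ absorb-separated t ss

  forestLeaves : List (BinTree n) → List (Fin n)
  forestLeaves = concatMap leaves

  absorb-leaves : ∀ t us → forestLeaves (absorb t us) ↭ leaves t ++ forestLeaves us
  absorb-leaves t []       = ↭-refl
  absorb-leaves t (u ∷ us) with adjacent? t u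
  ... | yes _ = begin
    forestLeaves (absorb (node t tt u) us)    ↭⟨ absorb-leaves (node t tt u) us ⟩
    leaves (node t tt u) ++ forestLeaves us   ≡⟨ cong (_++ forestLeaves us) (leaves-node t u) ⟩
    (leaves t ++ leaves u) ++ forestLeaves us ≡⟨ ++-assoc (leaves t) (leaves u) _ ⟩
    leaves t ++ leaves u ++ forestLeaves us   ∎
    where open PermutationReasoning
  ... | no _ = ↭-trans (++⁺ˡ (leaves u) (absorb-leaves t us)) (shifts (leaves u) (leaves t))

  merge : List (BinTree n) → List (BinTree n) → List (BinTree n)
  merge ts us = foldr absorb us ts

  merge-All : ∀ {P : BinTree n → Set p} →
              (∀ {t u} → Adjacent t u → P t → P u → P (node t tt u)) →
              ∀ {ts us} → All P ts → All P us → All P (merge ts us)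
  merge-All join []         pus = pus
  merge-All join (pt ∷ pts) pus = absorb-All join pt (merge-All join pts pus)

  merge-separated : ∀ ts {us} → AllPairs Separated us → AllPairs Separated (merge ts us)
  merge-separated []       ss = ss
  merge-separated (t ∷ ts) ss = absorb-separated t (merge-separated ts ss)

  merge-leaves : ∀ ts us → forestLeaves (merge ts us) ↭ forestLeaves ts ++ forestLeaves us
  merge-leaves []       us = ↭-refl
  merge-leaves (t ∷ ts) us = begin
    forestLeaves (merge (t ∷ ts) us)               ↭⟨ absorb-leaves t (merge ts us) ⟩
    leaves t ++ forestLeaves (merge ts us)         ↭⟨ ++⁺ˡ (leaves t) (merge-leaves ts us) ⟩
    leaves t ++ forestLeaves ts ++ forestLeaves us ≡⟨ ++-assoc (leaves t) _ _ ⟨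
    forestLeaves (t ∷ ts) ++ forestLeaves us       ∎
    where open PermutationReasoning

  ∪-inducesConnected : ∀ {p q a b} → a ∈ p → b ∈ q → a ~ b →
                       InducesConnected p → InducesConnected q → InducesConnected (p ∪ q)
  ∪-inducesConnected {p} {q} {a} {b} a∈p b∈q a~b cp cq x∈ y∈ =
    to-a x∈ ◅◅ reverse (λ (u∈ , v∈ , u~v) → v∈ , u∈ , ~-sym u~v) (to-a y∈)
    where
    to-a : ∀ {x} → x ∈ p ∪ q → Star (λ u v → u ∈ p ∪ q × v ∈ p ∪ q × u ~ v) x a
    to-a x∈ with x∈p∪q⁻ p q x∈
    ... | inj₁ x∈p = Star-map (λ (u∈ , v∈ , u~v) → x∈p∪q⁺ (inj₁ u∈) , x∈p∪q⁺ (inj₁ v∈) , u~v)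
                              (cp x∈p a∈p)
    ... | inj₂ x∈q = Star-map (λ (u∈ , v∈ , u~v) → x∈p∪q⁺ (inj₂ u∈) , x∈p∪q⁺ (inj₂ v∈) , u~v)
                              (cq x∈q b∈q)
                     ◅◅ (x∈p∪q⁺ (inj₂ b∈q) , x∈p∪q⁺ (inj₁ a∈p) , ~-sym a~b) ◅ ε

  ⁅⁆-inducesConnected : ∀ z → InducesConnected ⁅ z ⁆
  ⁅⁆-inducesConnected z x∈ y∈ with x∈⁅y⁆⇒x≡y z x∈ | x∈⁅y⁆⇒x≡y z y∈
  ... | refl | refl = ε

  closed⇒full : Connected → ∀ {p x} → (∀ {u v} → u ∈ p → u ~ v → v ∈ p) →
                x ∈ p → ∀ y → y ∈ p
  closed⇒full connected {p} closed x∈p y = walk x∈p (connected _ y)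
    where
    walk : ∀ {u} → u ∈ p → Star _~_ u y → y ∈ p
    walk u∈p ε          = u∈p
    walk u∈p (e ◅ path) = walk (closed u∈p e) path

  module _ (H : Hierarchy n) where

    record Part (A t : BinTree n) : Set where
      field
        within    : cluster t ⊆ cluster A
        connected : ∀ {s} → s ⊑ t → InducesConnected (cluster s)
        bounded   : ∀ {x y} → x ∈ cluster t → y ∈ cluster t → x ~ y →
                    ∣ cluster (lca t x y) ∣ ≤ ∣ C H x y ∣

    record Forest (A : BinTree n) : Set where
      field
        trees     : List (BinTree n)
        covers    : forestLeaves trees ↭ leaves A
        separated : AllPairs Separated trees
        parts     : All (Part A) trees

      closed : ∀ {t x y} → t List.∈ trees → x ∈ cluster t → y ∈ cluster A →
               x ~ y → y ∈ cluster t
      closed {t} {x} {y} t∈ x∈t y∈A x~y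
        with List.find (∈-concatMap⁻ leaves (∈-resp-↭ (↭-sym covers) (∈-leaves⁺ A y∈A)))
      ... | u , u∈ , y∈u
        with AllPairs-lookup (λ {v} {w} → Separated-sym v w) separated t∈ u∈
      ... | inj₁ refl = ∈-leaves⁻ t y∈u
      ... | inj₂ ¬tu  = contradiction (x , y , x∈t , ∈-leaves⁻ u y∈u , x~y) ¬tu

    -- The invariant while the parts of both children of A are being merged: an
    -- edge inside A leaving t crosses the split of A.
    record Mergeable (A t : BinTree n) : Set where
      field
        part    : Part A t
        leaving : ∀ {x y} → x ∈ cluster t → y ∈ cluster A → x ~ y →
                  y ∈ cluster t ⊎ ∣ cluster A ∣ ≤ ∣ C H x y ∣
      open Part part public

    mergeable-node : ∀ {A t u} → Adjacent t u → Mergeable A t → Mergeable A u →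
                     Mergeable A (node t tt u)
    mergeable-node {A} {t} {u} (a , b , a∈ , b∈ , a~b) mt mu = record
      { part = record
        { within    = within
        ; connected = λ
          { root      → ∪-inducesConnected a∈ b∈ a~b (T.connected root) (U.connected root)
          ; (left q)  → T.connected q
          ; (right q) → U.connected q
          }
        ; bounded   = bounded
        }
      ; leaving = leaving
      }
      where
      module T = Mergeable mt
      module U = Mergeable mu
      within : cluster (node t tt u) ⊆ cluster A
      within x∈ = [ T.within , U.within ] (x∈p∪q⁻ (cluster t) (cluster u) x∈)
      leaving : ∀ {x y} → x ∈ cluster (node t tt u) → y ∈ cluster A → x ~ y →
                y ∈ cluster (node t tt u) ⊎ ∣ cluster A ∣ ≤ ∣ C H x y ∣
      leaving x∈ y∈A x~y with x∈p∪q⁻ (cluster t) (cluster u) x∈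
      ... | inj₁ x∈t = map₁ (x∈p∪q⁺ ∘ inj₁) (T.leaving x∈t y∈A x~y)
      ... | inj₂ x∈u = map₁ (x∈p∪q⁺ ∘ inj₂) (U.leaving x∈u y∈A x~y)
      bounded : ∀ {x y} → x ∈ cluster (node t tt u) → y ∈ cluster (node t tt u) → x ~ y →
                ∣ cluster (lca (node t tt u) x y) ∣ ≤ ∣ C H x y ∣
      bounded {x} {y} x∈ y∈ x~y
        with x ∈? cluster t ×-dec y ∈? cluster t | x ∈? cluster u ×-dec y ∈? cluster u
      ... | yes (x∈t , y∈t) | _               = T.bounded x∈t y∈t x~y
      ... | no _            | yes (x∈u , y∈u) = U.bounded x∈u y∈u x~y
      ... | no ¬t           | no ¬u           = ≤-trans (p⊆q⇒∣p∣≤∣q∣ within)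
        ([ (λ x∈t → [ (λ y∈t → contradiction (x∈t , y∈t) ¬t) , id ] (T.leaving x∈t (within y∈) x~y))
         , (λ x∈u → [ (λ y∈u → contradiction (x∈u , y∈u) ¬u) , id ] (U.leaving x∈u (within y∈) x~y))
         ] (x∈p∪q⁻ (cluster t) (cluster u) x∈))

    leafForest : ∀ z → Forest (leaf z)
    leafForest z = record
      { trees     = leaf z ∷ []
      ; covers    = ↭-refl
      ; separated = [] ∷ []
      ; parts     = record
        { within    = id
        ; connected = λ { root → ⁅⁆-inducesConnected z }
        ; bounded   = λ {x} {y} x∈ y∈ x~y →
            contradiction x~y (~-irrefl (≡-trans (x∈⁅y⁆⇒x≡y z x∈) (sym (x∈⁅y⁆⇒x≡y z y∈))))
        } ∷ []
      }

    nodeForest : ∀ {l m r} → node l m r ⊑ tree H → Forest l → Forest r →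
                 Forest (node l m r)
    nodeForest {l} {m} {r} q Fl Fr = record
      { trees     = merge L.trees R.trees
      ; covers    = ↭-trans (merge-leaves L.trees R.trees)
                      (↭-trans (++⁺ L.covers R.covers) (↭-reflexive (sym (leaves-node l r))))
      ; separated = merge-separated L.trees R.separated
      ; parts     = All.map Mergeable.part (merge-All mergeable-node
                      (All.tabulate mergeableˡ) (All.tabulate mergeableʳ))
      }
      where
      module L = Forest Fl
      module R = Forest Fr
      crossing-bound : ∀ {x y} →
                       x ∈ cluster l × y ∈ cluster r ⊎ x ∈ cluster r × y ∈ cluster l →
                       ∣ cluster (node l m r) ∣ ≤ ∣ C H x y ∣
      crossing-bound xy = ≤-reflexive (cong (∣_∣ ∘ cluster) (sym (crossing-lca H q xy)))
      mergeableˡ : ∀ {t} → t List.∈ L.trees → Mergeable (node l m r) t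
      mergeableˡ t∈ = record
        { part = record
          { within    = x∈p∪q⁺ ∘ inj₁ ∘ P.within
          ; connected = P.connected
          ; bounded   = P.bounded
          }
        ; leaving = λ x∈ y∈ x~y →
            [ (λ y∈l → inj₁ (L.closed t∈ x∈ y∈l x~y))
            , (λ y∈r → inj₂ (crossing-bound (inj₁ (P.within x∈ , y∈r)))) ]
              (x∈p∪q⁻ (cluster l) (cluster r) y∈)
        }
        where module P = Part (All.lookup L.parts t∈)
      mergeableʳ : ∀ {t} → t List.∈ R.trees → Mergeable (node l m r) t
      mergeableʳ t∈ = record
        { part = record
          { within    = x∈p∪q⁺ ∘ inj₂ ∘ P.within
          ; connected = P.connected
          ; bounded   = P.bounded
          }
        ; leaving = λ x∈ y∈ x~y →
            [ (λ y∈l → inj₂ (crossing-bound (inj₂ (P.within x∈ , y∈l))))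
            , (λ y∈r → inj₁ (R.closed t∈ x∈ y∈r x~y)) ]
              (x∈p∪q⁻ (cluster l) (cluster r) y∈)
        }
        where module P = Part (All.lookup R.parts t∈)

    forest : ∀ A → A ⊑ tree H → Forest A
    forest (leaf z)     _ = leafForest z
    forest (node l _ r) q = nodeForest q (forest l (⊑-left q)) (forest r (⊑-right q))

    connectedHierarchy : Connected → ∃[ T ] ConnectedClusters G T ×
                         (∀ x y → x ~ y → ∣ C T x y ∣ ≤ ∣ C H x y ∣)
    connectedHierarchy G-connected = fromForest (forest (tree H) root)
      where
      occurs : ∀ x → x ∈ cluster (tree H)
      occurs x = ∈-leaves⁻ (tree H) (∈-resp-↭ (↭-sym (Hierarchy.leaves H)) (∈-allFin x))
      fromForest : Forest (tree H) → ∃[ T ] ConnectedClusters G T ×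
                   (∀ x y → x ~ y → ∣ C T x y ∣ ≤ ∣ C H x y ∣)
      fromForest record { trees = [] ; covers = covers } =
        let x , x∈ = cluster-nonempty (tree H)
        in case ∈-resp-↭ (↭-sym covers) (∈-leaves⁺ (tree H) x∈) of λ ()
      fromForest F@record { trees = t ∷ us ; covers = covers ; parts = part ∷ _ } =
        T , connected , λ x y → bounded (full x) (full y)
        where
        open Part part
        full : ∀ y → y ∈ cluster t
        full = closed⇒full G-connected
                 (λ x∈ x~y → Forest.closed F (here refl) x∈ (occurs _) x~y)
                 (proj₂ (cluster-nonempty t))
        unique : Unique (leaves t ++ forestLeaves us)
        unique = Unique-resp-↭ (setoid (Fin n)) (↭⇒↭ₛ (↭-sym covers)) (Hierarchy-unique H)
        us≡[] : ∀ us → Unique (leaves t ++ forestLeaves us) → us ≡ []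
        us≡[] []      _      = refl
        us≡[] (u ∷ _) unique =
          let y , y∈u = cluster-nonempty u
          in contradiction (∈-++⁺ˡ (∈-leaves⁺ u y∈u))
               (Unique-++⇒disjoint (leaves t) unique (∈-leaves⁺ t (full y)))
        T : Hierarchy n
        T = record
          { tree   = t
          ; leaves = begin
              leaves t                    ≡⟨ ++-identityʳ (leaves t) ⟨
              leaves t ++ []              ≡⟨ cong ((leaves t ++_) ∘ forestLeaves) (us≡[] us unique) ⟨
              leaves t ++ forestLeaves us ↭⟨ covers ⟩
              leaves (tree H)             ↭⟨ Hierarchy.leaves H ⟩
              allFin n                    ∎
          }
          where open PermutationReasoning

module _ (F : OrderedField c ℓ₁ ℓ₂) where
  open OrderedField F renaming (_≤_ to _≯_)
  open IsStrictPartialOrder isStrictPartialOrder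
    using (irrefl) renaming (<-respˡ-≈ to <-respˡ; <-respʳ-≈ to <-respʳ)
  open CommutativeRing commutativeRing
    using (ring; +-group; +-comm; +-congˡ; +-congʳ; +-identityˡ; *-congˡ; *-identityˡ;
           *-comm; distribˡ; -‿inverseʳ)
    renaming (refl to ≈-refl; trans to ≈-trans)
  open RingProperties ring using (-1*x≈-x; -0#≈0#; -‿involutive)
  open GroupProperties +-group using (//-rightDividesˡ)

  strictPartialOrder : StrictPartialOrder _ _ _
  strictPartialOrder = record { isStrictPartialOrder = isStrictPartialOrder }

  open StrictPartialOrderReasoning strictPartialOrder

  -- Stronger than _≯_, since _<_ is not assumed to be total.
  open StrictToNonStrict _≈_ _<_ using () renaming (_≤_ to _≲_)

  ≲⇒≯ : ∀ {x y} → x ≲ y → x ≯ y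
  ≲⇒≯ x≲y y<x = irrefl ≈-refl (begin-strict _ ≤⟨ x≲y ⟩ _ <⟨ y<x ⟩ _ ∎)

  +-monoˡ-≲ : ∀ {x y} z → x ≲ y → (x + z) ≲ (y + z)
  +-monoˡ-≲ z (inj₁ x<y) = inj₁ (+-monoˡ-< z x<y)
  +-monoˡ-≲ z (inj₂ x≈y) = inj₂ (+-congʳ x≈y)

  +-mono-≲ : ∀ {x y u v} → x ≲ y → u ≲ v → (x + u) ≲ (y + v)
  +-mono-≲ {x} {y} {u} {v} x≲y u≲v = begin
    x + u ≤⟨ +-monoˡ-≲ u x≲y ⟩
    y + u ≈⟨ +-comm y u ⟩
    u + y ≤⟨ +-monoˡ-≲ y u≲v ⟩
    v + y ≈⟨ +-comm v y ⟩
    y + v ∎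

  *-monoˡ-< : ∀ {w x y} → 0# < w → x < y → (w * x) < (w * y)
  *-monoˡ-< {w} {x} {y} 0<w x<y = begin-strict
    w * x                 ≈⟨ +-identityˡ (w * x) ⟨
    0# + w * x            <⟨ +-monoˡ-< (w * x) (*-pos 0<w 0<y-x) ⟩
    w * (y - x) + w * x   ≈⟨ distribˡ w (y - x) x ⟨
    w * ((y - x) + x)     ≈⟨ *-congˡ (//-rightDividesˡ x y) ⟩
    w * y                 ∎
    where
    0<y-x : 0# < (y - x)
    0<y-x = <-respˡ (-‿inverseʳ x) (+-monoˡ-< (- x) x<y)

  *-monoˡ-≲ : ∀ {w x y} → 0# < w → x ≲ y → (w * x) ≲ (w * y)
  *-monoˡ-≲ 0<w (inj₁ x<y) = inj₁ (*-monoˡ-< 0<w x<y)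
  *-monoˡ-≲ 0<w (inj₂ x≈y) = inj₂ (*-congˡ x≈y)

  0<1 : 0# < 1#
  0<1 with IsHeytingField.invertible⇒# isHeytingField
             (1# , ≈-trans (*-identityˡ _) 1-0≈1
                 , ≈-trans (*-comm _ _) (≈-trans (*-identityˡ _) 1-0≈1))
    where
    1-0≈1 : (1# - 0#) ≈ 1#
    1-0≈1 = ≈-trans (+-congˡ -0#≈0#) (≈-trans (+-comm 1# 0#) (+-identityˡ 1#))
  ... | inj₂ 0<1 = 0<1
  ... | inj₁ 1<0 = <-respʳ (≈-trans (-1*x≈-x (- 1#)) (-‿involutive 1#)) (*-pos 0<-1 0<-1)
    where
    0<-1 : 0# < (- 1#)
    0<-1 = begin-strict
      0#        ≈⟨ -‿inverseʳ 1# ⟨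
      1# - 1#   <⟨ +-monoˡ-< (- 1#) 1<0 ⟩
      0# - 1#   ≈⟨ +-identityˡ (- 1#) ⟩
      - 1#      ∎

  fromℕ-nonneg : ∀ k → 0# ≲ fromℕ k
  fromℕ-nonneg zero    = inj₂ ≈-refl
  fromℕ-nonneg (suc k) = begin
    0#            ≈⟨ +-identityˡ 0# ⟨
    0# + 0#       ≤⟨ +-mono-≲ (inj₁ 0<1) (fromℕ-nonneg k) ⟩
    1# + fromℕ k  ∎

  fromℕ-mono : ∀ {j k} → j ≤ k → fromℕ j ≲ fromℕ k
  fromℕ-mono {k = k} z≤n = fromℕ-nonneg k
  fromℕ-mono (s≤s j≤k)   = +-mono-≲ (inj₂ ≈-refl) (fromℕ-mono j≤k)

  sum-mono : ∀ {f g : A → Carrier} {xs} → All (λ x → f x ≲ g x) xs →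
             sum (map f xs) ≲ sum (map g xs)
  sum-mono []       = inj₂ ≈-refl
  sum-mono (p ∷ ps) = +-mono-≲ p (sum-mono ps)

  module _ {G : Graph n} (w : EdgeWeights F G) (T H : Hierarchy n)
           (T≤H : ∀ x y → Graph._~_ G x y → ∣ C T x y ∣ ≤ ∣ C H x y ∣) where
    open Graph G
    open EdgeWeights w

    edges-adjacent : All (λ (x , y) → x ~ y) edges
    edges-adjacent = All.map proj₂ (all-filter _ (cartesianProduct (allFin n) (allFin n)))

    costD-mono : costD F G w T ≯ costD F G w H
    costD-mono = ≲⇒≯ (sum-mono (All.map
      (λ {(x , y)} x~y → *-monoˡ-≲ (weight-pos x~y) (fromℕ-mono (T≤H x y x~y)))
      edges-adjacent))

    costD⁻-mono : costD⁻ F G w T ≯ costD⁻ F G w H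
    costD⁻-mono = ≲⇒≯ (sum-mono (All.map
      (λ {(x , y)} x~y →
         *-monoˡ-≲ (weight-pos x~y) (+-monoˡ-≲ (- 1#) (fromℕ-mono (T≤H x y x~y))))
      edges-adjacent))

lemma3 : ∀ {c ℓ₁ ℓ₂} (F : OrderedField c ℓ₁ ℓ₂) (n : ℕ) → 2 ≤ n →
    (G : Graph n) → Graph.Connected G →
    (w : EdgeWeights F G) (H : Hierarchy n) →
    ∃[ T ] ConnectedClusters G T
    × (∀ x y → Graph._~_ G x y → ∣ C T x y ∣ ≤ ∣ C H x y ∣)
    × OrderedField._≤_ F (costD⁻ F G w T) (costD⁻ F G w H)
    × OrderedField._≤_ F (costD F G w T) (costD F G w H)
lemma3 F n _ G G-connected w H =
  let T , connected , T≤H = connectedHierarchy G H G-connected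
  in T , connected , T≤H , costD⁻-mono F w T H T≤H , costD-mono F w T H T≤H
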